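{- Let $t\ge 2$ and $k\ge 2$ be integers satisfying $k(t-1)\ge t+1$. For every integer $m\ge k$, let $n=t+2m+1$ and $q=(n+t-1)/2$. Then, for every fixed $t$-element set $T\subseteq[n]$, there exists a $t$-intersecting $k$-Sperner family $\mathcal{F}\subseteq 2^{[n]}$ such that $|\mathcal{F}|>|\mathcal{B}_T(t,k)|$, where $$\mathcal{B}_T(t,k)=\mathcal{S}_T\cup\bigcup_{i=1}^{k-1}\binom{[n]}{q+i}\cup\left(\binom{[n]}{q+k}\setminus\nabla_{q+k}(\mathcal{S}_T)\right),\qquad \mathcal{S}_T=\left\{S\in\binom{[n]}{q}:T\subseteq S\right\}.$$
   Context: For a positive integer $n$, $[n]=\{1,2,\dots,n\}$ and $2^{[n]}$ is the power set of $[n]$. For a set $V$ and an integer $r$, $\binom{V}{r}$ denotes the family of all $r$-element subsets of $V$. A family $\mathcal{F}\subseteq 2^{[n]}$ is $t$-intersecting if $|A\cap B|\ge t$ for all $A,B\in\mathcal{F}$. A family $\mathcal{F}$ is $k$-Sperner if it contains no chain of length $k+1$, i.e., there do not exist sets $A_0\subset A_1\subset\cdots\subset A_k$ (strict inclusions) with all $A_i\in\mathcal{F}$. For a family $\mathcal{H}\subseteq\binom{[n]}{r}$ and an integer $s\ge r$, the $s$-th upper shadow of $\mathcal{H}$ is $$\nabla_s(\mathcal{H})=\left\{A\in\binom{[n]}{s}:\text{ there exists }F\in\mathcal{H}\text{ with }F\subseteq A\right\}.$$ -}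

module Defs where

open import Data.Fin.Base using (Fin; zero; suc; toℕ; inject₁)
open import Data.Fin.Properties using (any?)
open import Data.Fin.Subset using (Subset; inside; outside; ∣_∣; _⊆_; _⊂_)
  renaming (_∩_ to _∩ˢ_)
open import Data.Fin.Subset.Properties using (_⊆?_; anySubset?)
open import Data.List.Base using (List; []; _∷_; _++_; map; filter; length)
open import Data.List.Membership.Propositional using () renaming (_∈_ to _∈ˡ_)
open import Data.List.Membership.Propositional.Properties
  using (∈-map⁺; ∈-map⁻; ∈-++⁺ˡ; ∈-++⁺ʳ)
open import Data.List.Relation.Unary.All using ([])
open import Data.List.Relation.Unary.AllPairs using ([]; _∷_)
open import Data.List.Relation.Unary.Any using (here)
open import Data.List.Relation.Unary.Unique.Propositional using (Unique)
open import Data.List.Relation.Unary.Unique.Propositional.Properties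
  using (map⁺; ++⁺)
open import Data.Nat.Base using (ℕ; zero; suc; _+_; _∸_; _≥_)
open import Data.Nat.Properties using (_≟_)
open import Data.Product.Base using (∃-syntax; Σ-syntax; _×_; _,_)
open import Data.Vec.Base using ([]; _∷_)
open import Data.Vec.Properties using (∷-injectiveʳ)
open import Level using (0ℓ)
open import Relation.Binary.PropositionalEquality using (_≡_; refl)
open import Relation.Nullary.Decidable using (_×-dec_; ¬?)
open import Relation.Nullary.Negation using (¬_)
open import Relation.Unary using (Pred; Decidable; _∈_; _∪_; _∖_; ⋃)
open import Relation.Unary.Properties using (_∪?_)

-- The ground set [n] is represented by Fin n.

Family : ℕ → Set₁
Family n = Pred (Subset n) 0ℓ

subsets : ∀ n → List (Subset n)
subsets zero    = [] ∷ []
subsets (suc n) = map (outside ∷_) (subsets n) ++ map (inside ∷_) (subsets n)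

subsets-complete : ∀ {n} (A : Subset n) → A ∈ˡ subsets n
subsets-complete []            = here refl
subsets-complete (outside ∷ A) =
  ∈-++⁺ˡ (∈-map⁺ (outside ∷_) (subsets-complete A))
subsets-complete {suc n} (inside ∷ A) =
  ∈-++⁺ʳ (map (outside ∷_) (subsets n)) (∈-map⁺ (inside ∷_) (subsets-complete A))

subsets-unique : ∀ n → Unique (subsets n)
subsets-unique zero    = [] ∷ []
subsets-unique (suc n) =
  ++⁺ (map⁺ ∷-injectiveʳ (subsets-unique n))
      (map⁺ ∷-injectiveʳ (subsets-unique n))
      disjoint
  where
  disjoint : ∀ {A} → ¬ (A ∈ˡ map (outside ∷_) (subsets n) ×
                        A ∈ˡ map (inside ∷_) (subsets n))
  disjoint (p , q) with ∈-map⁻ (outside ∷_) p | ∈-map⁻ (inside ∷_) q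
  ... | _ , _ , refl | _ , _ , ()

-- |𝓕|.  By subsets-complete and subsets-unique each member is counted exactly
-- once; the value does not depend on the choice of decision procedure.

card : ∀ {n} {𝓕 : Family n} → Decidable 𝓕 → ℕ
card {n} 𝓕? = length (filter 𝓕? (subsets n))

Intersecting : ∀ {n} → ℕ → Family n → Set
Intersecting t 𝓕 = ∀ {A B} → A ∈ 𝓕 → B ∈ 𝓕 → ∣ A ∩ˢ B ∣ ≥ t

Sperner : ∀ {n} → ℕ → Family n → Set
Sperner {n} k 𝓕 =
  ¬ (Σ[ A ∈ (Fin (suc k) → Subset n) ]
       (∀ i → A i ∈ 𝓕) × (∀ (i : Fin k) → A (inject₁ i) ⊂ A (suc i)))

layer : ∀ {n} → ℕ → Family n
layer r A = ∣ A ∣ ≡ r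

∇ : ∀ {n} → ℕ → Family n → Family n
∇ s 𝓗 A = A ∈ layer s × (∃[ F ] (F ∈ 𝓗 × F ⊆ A))

𝓢 : ∀ {n} → ℕ → Subset n → Family n
𝓢 q T S = S ∈ layer q × T ⊆ S

-- The index i : Fin (k ∸ 1) stands for suc (toℕ i), which ranges over 1, …, k - 1.

𝓑 : ∀ {n} → ℕ → ℕ → Subset n → Family n
𝓑 q k T =
  𝓢 q T
  ∪ (⋃ (Fin (k ∸ 1)) λ i → layer (q + suc (toℕ i)))
  ∪ (layer (q + k) ∖ ∇ (q + k) (𝓢 q T))

layer? : ∀ {n} r → Decidable (layer {n} r)
layer? r A = ∣ A ∣ ≟ r

∇? : ∀ {n} s {𝓗 : Family n} → Decidable 𝓗 → Decidable (∇ s 𝓗)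
∇? s 𝓗? A = layer? s A ×-dec anySubset? (λ F → 𝓗? F ×-dec (F ⊆? A))

𝓢? : ∀ {n} q (T : Subset n) → Decidable (𝓢 q T)
𝓢? q T S = layer? q S ×-dec (T ⊆? S)

𝓑? : ∀ {n} q k (T : Subset n) → Decidable (𝓑 q k T)
𝓑? q k T =
  𝓢? q T
  ∪? ((λ A → any? λ i → layer? (q + suc (toℕ i)) A)
  ∪? (λ A → layer? (q + k) A ×-dec ¬? (∇? (q + k) (𝓢? q T) A)))

{-# OPTIONS --safe #-}
module Submission where

-- The competitor keeps the middle layers and replaces the trace condition T ⊆ A on
-- layers q and q+k by |A ∩ U| ≥ t+1, where |U| = t+2 (a Frankl family).  With c i the
-- binomial coefficient (2m−1 choose m+i), the gain in size is
-- (t−1) c 0 + c k − t c (k−1), that is, t−1 times the drop of c from 0 to k−1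
-- minus its drop from k−1 to k, and this is positive because (k−1)(t−1) ≥ 2.

open import Defs
open import Data.Bool.Base using (true; false)
open import Data.Empty using (⊥-elim)
open import Data.Fin.Base using (Fin; zero; suc; toℕ; inject₁; fromℕ)
open import Data.Fin.Properties using (any?; toℕ<n)
open import Data.Fin.Subset using (Subset; ∣_∣; _∩_; ∁; ⊤; ⊥; inside; outside; _⊆_; _⊂_)
open import Data.Fin.Subset.Properties
  using ( _∈?_; p∩q⊆p; p∩q⊆q; x∈p∩q⁺; p⊆q⇒∣p∣≤∣q∣; p⊂q⇒∣p∣<∣q∣; ∣∁p∣≡n∸∣p∣; ∣⊤∣≡n; ∣⊥∣≡0
        ; ∩-identityʳ; ⊆-max; ⊆-refl; ⊆-trans; drop-∷-⊆; out⊆; s⊆s)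
open import Data.List.Base using ([]; _∷_; map; filter; length)
open import Data.List.Properties using (length-++; filter-++; filter-≐)
open import Data.Nat
  using (ℕ; zero; suc; _+_; _*_; _∸_; _/_; _≤_; _<_; _≥_; _>_; z≤n; s≤s; _≤?_; _≟_; >-nonZero)
open import Data.Nat.Combinatorics using (_C_; nCn≡1; nC1≡n; nCk≡nC[n∸k]; nCk+nC[k+1]≡[n+1]C[k+1])
open import Data.Nat.DivMod using (m*n/n≡m)
open import Data.Nat.Properties
open import Data.Nat.Tactic.RingSolver using (solve-∀)
open import Data.Product using (Σ-syntax; ∃-syntax; _×_; _,_; proj₁; proj₂)
open import Data.Sum using (inj₁; inj₂)
open import Data.Vec.Base using ([]; _∷_; here)
open import Function.Base using (_∘_)
open import Level using (0ℓ)
open import Relation.Binary.PropositionalEquality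
  using (_≡_; refl; sym; trans; cong; cong₂; subst; subst₂; module ≡-Reasoning)
open import Relation.Nullary.Decidable using (yes; no; does; _×-dec_; ¬?)
open import Relation.Nullary.Negation using (¬_)
open import Relation.Unary using (Pred; Decidable; _≐_; _∪_; _∖_; ⋃)
open import Relation.Unary.Properties using (_∪?_)

-- Binomial coefficients

k≤n⇒0<nCk : ∀ {n k} → k ≤ n → 0 < n C k
k≤n⇒0<nCk {k = zero}      _         = s≤s z≤n
k≤n⇒0<nCk {suc n} {suc k} (s≤s k≤n) =
  subst (0 <_) (nCk+nC[k+1]≡[n+1]C[k+1] n k) (≤-trans (k≤n⇒0<nCk k≤n) (m≤m+n _ _))

-- The absorption identity, by induction on `n`: Pascal's rule splits the left binomial, the
-- induction hypothesis handles both halves, and Pascal's rule reassembles them.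
[k+1]*[n+1]C[k+1]≡[n+1]*nCk : ∀ n k → suc k * (suc n C suc k) ≡ suc n * (n C k)
[k+1]*[n+1]C[k+1]≡[n+1]*nCk n zero = begin
  1 * (suc n C 1)  ≡⟨ *-identityˡ _ ⟩
  suc n C 1        ≡⟨ nC1≡n (suc n) ⟩
  suc n            ≡⟨ *-identityʳ (suc n) ⟨
  suc n * 1        ∎
  where open ≡-Reasoning
[k+1]*[n+1]C[k+1]≡[n+1]*nCk zero    (suc k) = *-zeroʳ (suc (suc k))
[k+1]*[n+1]C[k+1]≡[n+1]*nCk (suc n) (suc k) = begin
  suc (suc k) * (suc (suc n) C suc (suc k))
    ≡⟨ cong (suc (suc k) *_) (nCk+nC[k+1]≡[n+1]C[k+1] (suc n) (suc k)) ⟨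
  suc (suc k) * (x + y)
    ≡⟨ *-distribˡ-+ (suc (suc k)) x y ⟩
  (x + suc k * x) + suc (suc k) * y
    ≡⟨ cong₂ (λ a b → (x + a) + b)
         ([k+1]*[n+1]C[k+1]≡[n+1]*nCk n k) ([k+1]*[n+1]C[k+1]≡[n+1]*nCk n (suc k)) ⟩
  (x + suc n * (n C k)) + suc n * (n C suc k)
    ≡⟨ +-assoc x _ _ ⟩
  x + (suc n * (n C k) + suc n * (n C suc k))
    ≡⟨ cong (x +_) (*-distribˡ-+ (suc n) (n C k) (n C suc k)) ⟨
  x + suc n * (n C k + n C suc k)
    ≡⟨ cong (λ a → x + suc n * a) (nCk+nC[k+1]≡[n+1]C[k+1] n k) ⟩
  suc (suc n) * x ∎
  where
  open ≡-Reasoning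
  x = suc n C suc k
  y = suc n C suc (suc k)

-- The ratio of neighbouring binomials: absorption combined with Pascal's rule, with the common term
-- cancelled. Writing n as `k + r` avoids truncated subtraction.
[k+1]*nC[k+1]≡[n-k]*nCk : ∀ {n} k r → n ≡ k + r → suc k * (n C suc k) ≡ r * (n C k)
[k+1]*nC[k+1]≡[n-k]*nCk k r refl = +-cancelˡ-≡ (suc k * a) _ _ (begin
  suc k * a + suc k * b  ≡⟨ *-distribˡ-+ (suc k) a b ⟨
  suc k * (a + b)        ≡⟨ cong (suc k *_) (nCk+nC[k+1]≡[n+1]C[k+1] (k + r) k) ⟩
  suc k * (suc (k + r) C suc k)
                         ≡⟨ [k+1]*[n+1]C[k+1]≡[n+1]*nCk (k + r) k ⟩
  suc (k + r) * a        ≡⟨ *-distribʳ-+ a (suc k) r ⟩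
  suc k * a + r * a      ∎)
  where
  open ≡-Reasoning
  a = (k + r) C k
  b = (k + r) C suc k

[n+2]C[k+2]≡ : ∀ n k → (2 + n) C (2 + k) ≡ n C k + 2 * (n C suc k) + n C (2 + k)
[n+2]C[k+2]≡ n k = begin
  (2 + n) C (2 + k)
    ≡⟨ nCk+nC[k+1]≡[n+1]C[k+1] (suc n) (suc k) ⟨
  suc n C suc k + suc n C (2 + k)
    ≡⟨ cong₂ _+_ (nCk+nC[k+1]≡[n+1]C[k+1] n k) (nCk+nC[k+1]≡[n+1]C[k+1] n (suc k)) ⟨
  (n C k + n C suc k) + (n C suc k + n C (2 + k))
    ≡⟨ lemma (n C k) (n C suc k) (n C (2 + k)) ⟩
  n C k + 2 * (n C suc k) + n C (2 + k) ∎
  where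
  open ≡-Reasoning
  lemma : ∀ x y z → (x + y) + (y + z) ≡ x + 2 * y + z
  lemma = solve-∀

-- For m = p + 1, c i and e i are the binomial coefficients (2m−1 choose m+i)
-- and (2m choose m+i).  The drop c i − c (i+1) equals ((i+1)/m) · e (i+1), and e
-- decreases, so the first j drops add up to at least j(j+1)/(2m) · e j, while
-- the next one is smaller than (j+1)/m · e j.

module CentralDrops (p : ℕ) where

  c e : ℕ → ℕ
  c i = suc (p + p) C (suc p + i)
  e i = (2 + (p + p)) C (suc p + i)

  e≡c+c : ∀ i → e (suc i) ≡ c i + c (suc i)
  e≡c+c i = begin
    (2 + (p + p)) C (suc p + suc i)
      ≡⟨ cong ((2 + (p + p)) C_) (+-suc (suc p) i) ⟩
    (2 + (p + p)) C suc (suc p + i)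
      ≡⟨ nCk+nC[k+1]≡[n+1]C[k+1] (suc (p + p)) (suc p + i) ⟨
    c i + suc (p + p) C suc (suc p + i)
      ≡⟨ cong (λ x → c i + suc (p + p) C x) (+-suc (suc p) i) ⟨
    c i + c (suc i) ∎
    where open ≡-Reasoning

  c-drop : ∀ {i} → i ≤ p → suc p * c (suc i) + suc i * e (suc i) ≡ suc p * c i
  c-drop {i} i≤p = begin
    suc p * c (suc i) + suc i * e (suc i)
      ≡⟨ cong (λ x → suc p * c (suc i) + suc i * x) (e≡c+c i) ⟩
    suc p * c (suc i) + suc i * (c i + c (suc i))
      -- Collecting the coefficients of `c (suc i)` gives m + i + 1, which is what the ratio of
      -- neighbouring binomials needs.
      ≡⟨ regroup p i (c i) (c (suc i)) ⟩
    suc (suc p + i) * c (suc i) + suc i * c i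
      ≡⟨ cong (λ x → suc (suc p + i) * (suc (p + p) C x) + suc i * c i) (+-suc (suc p) i) ⟩
    suc (suc p + i) * (suc (p + p) C suc (suc p + i)) + suc i * c i
      ≡⟨ cong (_+ suc i * c i)
           ([k+1]*nC[k+1]≡[n-k]*nCk (suc p + i) (p ∸ i) split) ⟩
    (p ∸ i) * c i + suc i * c i
      ≡⟨ *-distribʳ-+ (c i) (p ∸ i) (suc i) ⟨
    ((p ∸ i) + suc i) * c i
      ≡⟨ cong (_* c i) (trans (+-suc (p ∸ i) i) (cong suc (m∸n+n≡m i≤p))) ⟩
    suc p * c i ∎
    where
    open ≡-Reasoning
    regroup : ∀ p i x y → suc p * y + suc i * (x + y) ≡ suc (suc p + i) * y + suc i * x
    regroup = solve-∀
    split : suc (p + p) ≡ suc p + i + (p ∸ i)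
    split = sym (trans (+-assoc (suc p) i (p ∸ i)) (cong (suc p +_) (m+[n∸m]≡n i≤p)))

  -- The ratio of e (i+1) to e i is (m - i)/(m + i + 1), which is below 1; strictness also needs e i
  -- to be positive.
  e-strictly-decreasing : ∀ {i} → i ≤ p → e (suc i) < e i
  e-strictly-decreasing {i} i≤p = *-cancelˡ-< (suc (suc p + i)) _ _ (begin-strict
    suc (suc p + i) * e (suc i)
      ≡⟨ cong (λ x → suc (suc p + i) * ((2 + (p + p)) C x)) (+-suc (suc p) i) ⟩
    suc (suc p + i) * ((2 + (p + p)) C suc (suc p + i))
      ≡⟨ [k+1]*nC[k+1]≡[n-k]*nCk (suc p + i) (suc (p ∸ i)) split ⟩
    suc (p ∸ i) * e i
      <⟨ *-monoˡ-< (e i) {{>-nonZero (k≤n⇒0<nCk m+i≤2m)}} (s≤s (s≤s (≤-trans (m∸n≤m p i) (m≤m+n p i)))) ⟩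
    suc (suc p + i) * e i ∎)
    where
    open ≤-Reasoning
    m+i≤2m : suc p + i ≤ 2 + (p + p)
    m+i≤2m = m≤n⇒m≤1+n (+-monoʳ-≤ (suc p) i≤p)
    split : 2 + (p + p) ≡ suc p + i + suc (p ∸ i)
    split = sym (trans (+-assoc (suc p) i _)
              (trans (cong (suc p +_) (trans (+-suc i (p ∸ i)) (cong suc (m+[n∸m]≡n i≤p))))
                (+-suc (suc p) p)))

  -- By `c-drop`, 2m times the drop from i to i + 1 is 2(i + 1) e (i+1). As e decreases, each of the
  -- first j factors e (i+1) is at least e j, and 2 + 4 + ... + 2j = j(j + 1).
  c-total-drop : ∀ j → j ≤ p → 2 * (suc p * c j) + j * suc j * e j ≤ 2 * (suc p * c 0)
  c-total-drop zero    _   = ≤-reflexive (+-identityʳ _)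
  c-total-drop (suc j) j<p = begin
    2 * (suc p * c (suc j)) + suc j * suc (suc j) * e (suc j)
      ≡⟨ regroup j (suc p * c (suc j)) (e (suc j)) ⟩
    2 * (suc p * c (suc j) + suc j * e (suc j)) + j * suc j * e (suc j)
      ≡⟨ cong (λ x → 2 * x + j * suc j * e (suc j)) (c-drop j≤p) ⟩
    2 * (suc p * c j) + j * suc j * e (suc j)
      ≤⟨ +-monoʳ-≤ (2 * (suc p * c j))
           (*-monoʳ-≤ (j * suc j) (<⇒≤ (e-strictly-decreasing j≤p))) ⟩
    2 * (suc p * c j) + j * suc j * e j
      ≤⟨ c-total-drop j j≤p ⟩
    2 * (suc p * c 0) ∎
    where
    open ≤-Reasoning
    j≤p = <⇒≤ j<p
    regroup : ∀ j x y → 2 * x + suc j * suc (suc j) * y ≡ 2 * (x + suc j * y) + j * suc j * y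
    regroup = solve-∀

  -- For u = t - 1 and j = k - 1 this is positivity of the gain in size. It is proved after
  -- multiplication by 2m, so that the drops become integer multiples of e.
  next-drop< : ∀ u j → 2 ≤ u * j → j ≤ p → suc u * c j < u * c 0 + c (suc j)
  next-drop< u j 2≤uj j≤p = *-cancelˡ-< (2 * suc p) _ _ (begin-strict
    2 * suc p * (suc u * c j)
      ≡⟨ split p u (c j) ⟩
    u * (2 * (suc p * c j)) + 2 * (suc p * c j)
      ≡⟨ cong (λ x → u * (2 * (suc p * c j)) + 2 * x) (c-drop j≤p) ⟨
    u * (2 * (suc p * c j)) + 2 * (suc p * c (suc j) + suc j * e (suc j))
      <⟨ +-monoʳ-< (u * (2 * (suc p * c j)))
           (*-monoʳ-< 2 (+-monoʳ-< (suc p * c (suc j))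
             (*-monoʳ-< (suc j) (e-strictly-decreasing j≤p)))) ⟩
    u * (2 * (suc p * c j)) + 2 * (suc p * c (suc j) + suc j * e j)
      ≡⟨ regroup j (u * (2 * (suc p * c j))) (suc p * c (suc j)) (e j) ⟩
    u * (2 * (suc p * c j)) + 2 * (suc j * e j) + 2 * (suc p * c (suc j))
      -- The next drop costs less than 2(j + 1) e j. Since 2 ≤ u j, this is at most u times j(j + 1)
      -- e j, the lower bound for the total drop.
      ≤⟨ +-monoˡ-≤ (2 * (suc p * c (suc j)))
           (+-monoʳ-≤ (u * (2 * (suc p * c j))) (*-monoˡ-≤ (suc j * e j) 2≤uj)) ⟩
    u * (2 * (suc p * c j)) + u * j * (suc j * e j) + 2 * (suc p * c (suc j))
      ≡⟨ cong (_+ 2 * (suc p * c (suc j))) (factor u j (2 * (suc p * c j)) (e j)) ⟩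
    u * (2 * (suc p * c j) + j * suc j * e j) + 2 * (suc p * c (suc j))
      ≤⟨ +-monoˡ-≤ (2 * (suc p * c (suc j))) (*-monoʳ-≤ u (c-total-drop j j≤p)) ⟩
    u * (2 * (suc p * c 0)) + 2 * (suc p * c (suc j))
      ≡⟨ collect p u (c 0) (c (suc j)) ⟩
    2 * suc p * (u * c 0 + c (suc j)) ∎)
    where
    open ≤-Reasoning
    split : ∀ p u x → 2 * suc p * (suc u * x) ≡ u * (2 * (suc p * x)) + 2 * (suc p * x)
    split = solve-∀
    regroup : ∀ j x y z → x + 2 * (y + suc j * z) ≡ x + 2 * (suc j * z) + 2 * y
    regroup = solve-∀
    factor : ∀ u j x y → u * x + u * j * (suc j * y) ≡ u * (x + j * suc j * y)
    factor = solve-∀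
    collect : ∀ p u x y → u * (2 * (suc p * x)) + 2 * (suc p * y) ≡ 2 * suc p * (u * x + y)
    collect = solve-∀

-- The left side will count the bottom part of 𝓑 plus the removed top part of the competitor; the
-- right side has the two roles exchanged. Applying Pascal's rule twice to each `2 + v` term leaves
-- only `next-drop<` after cancellation.
trace-count-< : ∀ u j r → 2 ≤ u * j → j ≤ suc r →
  let p = suc r
      v = suc (p + p)
  in (2 + v) C suc p + ((3 + u) * (v C suc (p + j)) + v C (p + j))
   < ((3 + u) * (v C p) + v C r) + (2 + v) C (2 + (p + j))
trace-count-< u j r 2≤uj j≤p = begin-strict
  (2 + v) C suc p + (S * y + z)
    ≡⟨ cong (_+ (S * y + z)) ([n+2]C[k+2]≡ v r) ⟩
  v C r + 2 * x + v C suc p + (S * y + z)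
    ≡⟨ cong (λ a → v C r + 2 * x + a + (S * y + z)) (sym x≡c0) ⟩
  v C r + 2 * x + x + (S * y + z)
    ≡⟨ left u (v C r) x y z ⟩
  (v C r + 3 * x + 2 * y + z) + suc u * y
    <⟨ +-monoʳ-< (v C r + 3 * x + 2 * y + z) bound ⟩
  (v C r + 3 * x + 2 * y + z) + (u * x + w)
    ≡⟨ right u (v C r) x y z w ⟩
  (S * x + v C r) + (z + 2 * y + w)
    ≡⟨ cong ((S * x + v C r) +_) ([n+2]C[k+2]≡ v (p + j)) ⟨
  (S * x + v C r) + (2 + v) C (2 + (p + j)) ∎
  where
  open ≤-Reasoning
  p = suc r
  v = suc (p + p)
  S = 3 + u
  x = v C p
  y = v C suc (p + j)
  z = v C (p + j)
  w = v C (2 + (p + j))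
  open CentralDrops p using (next-drop<)
  -- The row v = 2p + 1 is odd, so its two central entries, at p and p + 1, agree by symmetry.
  x≡c0 : x ≡ v C suc p
  x≡c0 = trans (nCk≡nC[n∸k] (m≤n⇒m≤1+n (m≤m+n p p)))
           (cong (v C_) (trans (+-∸-assoc 1 (m≤m+n p p)) (cong suc (m+n∸m≡n p p))))
  bound : suc u * y < u * x + w
  bound = subst₂ (λ a b → suc u * y < u * a + v C b)
            (trans (cong (v C_) (+-identityʳ (suc p))) (sym x≡c0)) (+-suc (suc p) j)
            (next-drop< u j 2≤uj j≤p)
  left : ∀ u a x y z →
    a + 2 * x + x + ((3 + u) * y + z) ≡ (a + 3 * x + 2 * y + z) + suc u * y
  left = solve-∀
  right : ∀ u a x y z w →
    (a + 3 * x + 2 * y + z) + (u * x + w) ≡ ((3 + u) * x + a) + (z + 2 * y + w)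
  right = solve-∀

-- Cardinalities of families

card-≐ : ∀ {n} {P Q : Family n} (P? : Decidable P) (Q? : Decidable Q) →
         P ≐ Q → card P? ≡ card Q?
card-≐ P? Q? P≐Q = cong length (filter-≐ P? Q? P≐Q (subsets _))

length-filter-map : ∀ {A B : Set} {P : Pred B 0ℓ} (P? : Decidable P) (f : A → B) xs →
                    length (filter P? (map f xs)) ≡ length (filter (λ x → P? (f x)) xs)
length-filter-map P? f []       = refl
length-filter-map P? f (x ∷ xs) with does (P? (f x))
... | true  = cong suc (length-filter-map P? f xs)
... | false = length-filter-map P? f xs

card-suc : ∀ {n} {P : Family (suc n)} (P? : Decidable P) →
           card P? ≡ card (λ A → P? (outside ∷ A)) + card (λ A → P? (inside ∷ A))
card-suc {n} P? = begin
  card P?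
    ≡⟨ cong length (filter-++ P? (map (outside ∷_) (subsets n)) _) ⟩
  _ ≡⟨ length-++ (filter P? (map (outside ∷_) (subsets n))) ⟩
  _ ≡⟨ cong₂ _+_ (length-filter-map P? (outside ∷_) (subsets n))
                 (length-filter-map P? (inside ∷_) (subsets n)) ⟩
  _ ∎
  where open ≡-Reasoning

card-∪ : ∀ {n} {P Q : Family n} (P? : Decidable P) (Q? : Decidable Q) →
         (∀ {A} → P A → ¬ Q A) → card (P? ∪? Q?) ≡ card P? + card Q?
card-∪ {n} P? Q? disjoint = go (subsets n)
  where
  go : ∀ xs → length (filter (P? ∪? Q?) xs) ≡ length (filter P? xs) + length (filter Q? xs)
  go []       = refl
  go (x ∷ xs) with P? x | Q? x
  ... | yes p | yes q = ⊥-elim (disjoint p q)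
  ... | yes p | no ¬q = cong suc (go xs)
  ... | no ¬p | yes q = trans (cong suc (go xs)) (sym (+-suc _ _))
  ... | no ¬p | no ¬q = go xs

card-empty : ∀ {n} {P : Family n} (P? : Decidable P) → (∀ {A} → ¬ P A) → card P? ≡ 0
card-empty {n} P? empty = go (subsets n)
  where
  go : ∀ xs → length (filter P? xs) ≡ 0
  go []       = refl
  go (x ∷ xs) with P? x
  ... | yes p = ⊥-elim (empty p)
  ... | no ¬p = go xs

card-∖ : ∀ {n} {L Y : Family n} (L? : Decidable L) (Y? : Decidable Y) →
         (∀ {A} → Y A → L A) → card (λ A → L? A ×-dec ¬? (Y? A)) + card Y? ≡ card L?
card-∖ {L = L} {Y} L? Y? Y⊆L =
  trans (sym (card-∪ L∖Y? Y? proj₂)) (card-≐ (L∖Y? ∪? Y?) L? (to , from))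
  where
  L∖Y? : Decidable (L ∖ Y)
  L∖Y? A = L? A ×-dec ¬? (Y? A)
  to : ∀ {A} → ((L ∖ Y) ∪ Y) A → L A
  to (inj₁ (l , _)) = l
  to (inj₂ y)       = Y⊆L y
  from : ∀ {A} → L A → ((L ∖ Y) ∪ Y) A
  from {A} l with Y? A
  ... | yes y = inj₂ y
  ... | no ¬y = inj₁ (l , ¬y)

-- Subsets with prescribed traces

∣p∣≡∣p∩q∣+∣p∩∁q∣ : ∀ {n} (p q : Subset n) → ∣ p ∣ ≡ ∣ p ∩ q ∣ + ∣ p ∩ ∁ q ∣
∣p∣≡∣p∩q∣+∣p∩∁q∣ []            []            = refl
∣p∣≡∣p∩q∣+∣p∩∁q∣ (outside ∷ p) (_ ∷ q)       = ∣p∣≡∣p∩q∣+∣p∩∁q∣ p q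
∣p∣≡∣p∩q∣+∣p∩∁q∣ (inside ∷ p)  (inside ∷ q)  = cong suc (∣p∣≡∣p∩q∣+∣p∩∁q∣ p q)
∣p∣≡∣p∩q∣+∣p∩∁q∣ (inside ∷ p)  (outside ∷ q) =
  trans (cong suc (∣p∣≡∣p∩q∣+∣p∩∁q∣ p q)) (sym (+-suc _ _))

-- Inclusion-exclusion inside `u`: the union of the two traces has at most `∣ u ∣` elements, and
-- their intersection lies in `p ∩ q`. The induction checks this one coordinate at a time.
∣p∩u∣+∣q∩u∣≤∣u∣+∣p∩q∣ : ∀ {n} (p q u : Subset n) →
                       ∣ p ∩ u ∣ + ∣ q ∩ u ∣ ≤ ∣ u ∣ + ∣ p ∩ q ∣
∣p∩u∣+∣q∩u∣≤∣u∣+∣p∩q∣ []            []            []            = z≤n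
∣p∩u∣+∣q∩u∣≤∣u∣+∣p∩q∣ (outside ∷ p) (outside ∷ q) (outside ∷ u) = ∣p∩u∣+∣q∩u∣≤∣u∣+∣p∩q∣ p q u
∣p∩u∣+∣q∩u∣≤∣u∣+∣p∩q∣ (outside ∷ p) (inside ∷ q)  (outside ∷ u) = ∣p∩u∣+∣q∩u∣≤∣u∣+∣p∩q∣ p q u
∣p∩u∣+∣q∩u∣≤∣u∣+∣p∩q∣ (inside ∷ p)  (outside ∷ q) (outside ∷ u) = ∣p∩u∣+∣q∩u∣≤∣u∣+∣p∩q∣ p q u
∣p∩u∣+∣q∩u∣≤∣u∣+∣p∩q∣ (inside ∷ p)  (inside ∷ q)  (outside ∷ u) =
  ≤-trans (m≤n⇒m≤1+n (∣p∩u∣+∣q∩u∣≤∣u∣+∣p∩q∣ p q u)) (≤-reflexive (sym (+-suc _ _)))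
∣p∩u∣+∣q∩u∣≤∣u∣+∣p∩q∣ (outside ∷ p) (outside ∷ q) (inside ∷ u)  =
  m≤n⇒m≤1+n (∣p∩u∣+∣q∩u∣≤∣u∣+∣p∩q∣ p q u)
∣p∩u∣+∣q∩u∣≤∣u∣+∣p∩q∣ (outside ∷ p) (inside ∷ q)  (inside ∷ u)  =
  ≤-trans (≤-reflexive (+-suc _ _)) (s≤s (∣p∩u∣+∣q∩u∣≤∣u∣+∣p∩q∣ p q u))
∣p∩u∣+∣q∩u∣≤∣u∣+∣p∩q∣ (inside ∷ p)  (outside ∷ q) (inside ∷ u)  =
  s≤s (∣p∩u∣+∣q∩u∣≤∣u∣+∣p∩q∣ p q u)
∣p∩u∣+∣q∩u∣≤∣u∣+∣p∩q∣ (inside ∷ p)  (inside ∷ q)  (inside ∷ u)  =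
  s≤s (≤-trans (≤-reflexive (+-suc _ _))
        (≤-trans (s≤s (∣p∩u∣+∣q∩u∣≤∣u∣+∣p∩q∣ p q u)) (≤-reflexive (sym (+-suc _ _)))))

∣p∣+∣q∣≤n+∣p∩q∣ : ∀ {n} (p q : Subset n) → ∣ p ∣ + ∣ q ∣ ≤ n + ∣ p ∩ q ∣
∣p∣+∣q∣≤n+∣p∩q∣ {n} p q = subst₂ _≤_
  (cong₂ (λ a b → ∣ a ∣ + ∣ b ∣) (∩-identityʳ p) (∩-identityʳ q))
  (cong (_+ ∣ p ∩ q ∣) (∣⊤∣≡n n))
  (∣p∩u∣+∣q∩u∣≤∣u∣+∣p∩q∣ p q ⊤)

q⊆p⇒∣q∣≤∣p∩q∣ : ∀ {n} {p q : Subset n} → q ⊆ p → ∣ q ∣ ≤ ∣ p ∩ q ∣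
q⊆p⇒∣q∣≤∣p∩q∣ q⊆p = p⊆q⇒∣p∣≤∣q∣ (λ x∈q → x∈p∩q⁺ (q⊆p x∈q , x∈q))

∣q∣≤∣p∩q∣⇒q⊆p : ∀ {n} {p q : Subset n} → ∣ q ∣ ≤ ∣ p ∩ q ∣ → q ⊆ p
∣q∣≤∣p∩q∣⇒q⊆p {p = p} {q} ∣q∣≤ {x} x∈q with x ∈? p
... | yes x∈p = x∈p
... | no  x∉p = ⊥-elim (<⇒≱ (p⊂q⇒∣p∣<∣q∣ (p∩q⊆q p q , x , x∈q , x∉p ∘ p∩q⊆p p q)) ∣q∣≤)

between : ∀ {n} {p r : Subset n} s → p ⊆ r → ∣ p ∣ ≤ s → s ≤ ∣ r ∣ →
          ∃[ q ] (p ⊆ q × q ⊆ r × ∣ q ∣ ≡ s)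
between {p = []} {[]} zero _ _ _ = [] , (λ ()) , (λ ()) , refl
between {p = outside ∷ p} {outside ∷ r} s p⊆r ∣p∣≤s s≤∣r∣
  with q , p⊆q , q⊆r , refl ← between s (drop-∷-⊆ p⊆r) ∣p∣≤s s≤∣r∣
  = outside ∷ q , out⊆ p⊆q , out⊆ q⊆r , refl
between {p = inside ∷ p} {outside ∷ r} s p⊆r _ _ with () ← p⊆r here
between {p = inside ∷ p} {inside ∷ r} (suc s) p⊆r (s≤s ∣p∣≤s) (s≤s s≤∣r∣)
  with q , p⊆q , q⊆r , refl ← between s (drop-∷-⊆ p⊆r) ∣p∣≤s s≤∣r∣
  = inside ∷ q , s⊆s p⊆q , s⊆s q⊆r , refl
between {p = outside ∷ p} {inside ∷ r} s p⊆r ∣p∣≤s s≤1+∣r∣ with s ≤? ∣ r ∣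
... | yes s≤∣r∣
  with q , p⊆q , q⊆r , refl ← between s (drop-∷-⊆ p⊆r) ∣p∣≤s s≤∣r∣
  = outside ∷ q , out⊆ p⊆q , out⊆ q⊆r , refl
-- Here s is exactly `suc ∣ r ∣`, so the whole upper set is the only choice.
... | no s≰∣r∣ = inside ∷ r , p⊆r , ⊆-refl , ≤-antisym (≰⇒> s≰∣r∣) s≤1+∣r∣

traces : ∀ {n} → Subset n → ℕ → ℕ → Family n
traces U a b A = ∣ A ∩ U ∣ ≡ a × ∣ A ∩ ∁ U ∣ ≡ b

traces? : ∀ {n} (U : Subset n) a b → Decidable (traces U a b)
traces? U a b A = (∣ A ∩ U ∣ ≟ a) ×-dec (∣ A ∩ ∁ U ∣ ≟ b)

-- The choices inside and outside `U` are independent, hence the product. In the induction the first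
-- coordinate enlarges just one of the two ground sets, and Pascal's rule acts on that factor.
card-traces : ∀ {n} (U : Subset n) a b →
              card (traces? U a b) ≡ (∣ U ∣ C a) * (∣ ∁ U ∣ C b)
card-traces [] zero    zero    = refl
card-traces [] zero    (suc b) = refl
card-traces [] (suc a) b       = refl
card-traces (outside ∷ U) a zero = begin
  _ ≡⟨ card-suc (traces? (outside ∷ U) a 0) ⟩
  _ ≡⟨ cong₂ _+_ (card-traces U a 0)
         (card-empty (λ A → traces? (outside ∷ U) a 0 (inside ∷ A)) λ ()) ⟩
  _ ≡⟨ +-identityʳ _ ⟩
  _ ∎
  where open ≡-Reasoning
card-traces (outside ∷ U) a (suc b) = begin
  _ ≡⟨ card-suc (traces? (outside ∷ U) a (suc b)) ⟩
  _ ≡⟨ cong (card (traces? U a (suc b)) +_)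
         (card-≐ (λ A → traces? (outside ∷ U) a (suc b) (inside ∷ A)) (traces? U a b)
           ((λ { (x , y) → x , suc-injective y }) , (λ { (x , y) → x , cong suc y }))) ⟩
  _ ≡⟨ cong₂ _+_ (card-traces U a (suc b)) (card-traces U a b) ⟩
  (∣ U ∣ C a) * (v C suc b) + (∣ U ∣ C a) * (v C b)
    ≡⟨ *-distribˡ-+ (∣ U ∣ C a) _ _ ⟨
  (∣ U ∣ C a) * (v C suc b + v C b)
    ≡⟨ cong ((∣ U ∣ C a) *_) (trans (+-comm (v C suc b) _) (nCk+nC[k+1]≡[n+1]C[k+1] v b)) ⟩
  _ ∎
  where
  open ≡-Reasoning
  v = ∣ ∁ U ∣
card-traces (inside ∷ U) zero b = begin
  _ ≡⟨ card-suc (traces? (inside ∷ U) 0 b) ⟩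
  _ ≡⟨ cong₂ _+_ (card-traces U 0 b)
         (card-empty (λ A → traces? (inside ∷ U) 0 b (inside ∷ A)) λ ()) ⟩
  _ ≡⟨ +-identityʳ _ ⟩
  _ ∎
  where open ≡-Reasoning
card-traces (inside ∷ U) (suc a) b = begin
  _ ≡⟨ card-suc (traces? (inside ∷ U) (suc a) b) ⟩
  _ ≡⟨ cong (card (traces? U (suc a) b) +_)
         (card-≐ (λ A → traces? (inside ∷ U) (suc a) b (inside ∷ A)) (traces? U a b)
           ((λ { (x , y) → suc-injective x , y }) , (λ { (x , y) → cong suc x , y }))) ⟩
  _ ≡⟨ cong₂ _+_ (card-traces U (suc a) b) (card-traces U a b) ⟩
  (u C suc a) * (∣ ∁ U ∣ C b) + (u C a) * (∣ ∁ U ∣ C b)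
    ≡⟨ *-distribʳ-+ (∣ ∁ U ∣ C b) (u C suc a) _ ⟨
  (u C suc a + u C a) * (∣ ∁ U ∣ C b)
    ≡⟨ cong (_* (∣ ∁ U ∣ C b)) (trans (+-comm (u C suc a) _) (nCk+nC[k+1]≡[n+1]C[k+1] u a)) ⟩
  _ ∎
  where
  open ≡-Reasoning
  u = ∣ U ∣

-- A common form for both families: s = `∣ U ∣` gives the star of `U` in a layer, while `∣ U ∣` = t
-- + 2 with s = t + 1 gives the Frankl family.
𝓗 : ∀ {n} → Subset n → ℕ → ℕ → Family n
𝓗 U s r A = ∣ A ∣ ≡ r × s ≤ ∣ A ∩ U ∣

𝓗? : ∀ {n} (U : Subset n) s r → Decidable (𝓗 U s r)
𝓗? U s r A = (∣ A ∣ ≟ r) ×-dec (s ≤? ∣ A ∩ U ∣)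

module _ {n} (U : Subset n) where

  traces⇒∣A∣≡ : ∀ {a b} (A : Subset n) → traces U a b A → ∣ A ∣ ≡ a + b
  traces⇒∣A∣≡ A (refl , refl) = ∣p∣≡∣p∩q∣+∣p∩∁q∣ A U

  traces-intro : ∀ {a b} (A : Subset n) → ∣ A ∣ ≡ a + b → ∣ A ∩ U ∣ ≡ a → traces U a b A
  traces-intro A ∣A∣≡ refl =
    refl , +-cancelˡ-≡ (∣ A ∩ U ∣) _ _ (trans (sym (∣p∣≡∣p∩q∣+∣p∩∁q∣ A U)) ∣A∣≡)

  ∣A∩U∣≤∣U∣ : ∀ (A : Subset n) → ∣ A ∩ U ∣ ≤ ∣ U ∣
  ∣A∩U∣≤∣U∣ A = p⊆q⇒∣p∣≤∣q∣ (p∩q⊆q A U)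

  card-𝓗-∣U∣ : ∀ b → card (𝓗? U ∣ U ∣ (∣ U ∣ + b)) ≡ ∣ ∁ U ∣ C b
  card-𝓗-∣U∣ b = begin
    _ ≡⟨ card-≐ (𝓗? U ∣ U ∣ (∣ U ∣ + b)) (traces? U ∣ U ∣ b)
           ( (λ { {A} (r , s) → traces-intro A r (≤-antisym (∣A∩U∣≤∣U∣ A) s) })
           , (λ {A} tr → traces⇒∣A∣≡ A tr , ≤-reflexive (sym (proj₁ tr))) ) ⟩
    _ ≡⟨ card-traces U ∣ U ∣ b ⟩
    _ ≡⟨ cong (_* (∣ ∁ U ∣ C b)) (nCn≡1 ∣ U ∣) ⟩
    _ ≡⟨ *-identityˡ _ ⟩
    _ ∎
    where open ≡-Reasoning

  -- The trace on `U` either misses one element, in s + 1 ways, or is all of `U`. In the second case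
  -- one element fewer is chosen outside `U`.
  card-𝓗-∣U∣-1 : ∀ {s} → ∣ U ∣ ≡ suc s → ∀ b →
    card (𝓗? U s (s + suc b)) ≡ suc s * (∣ ∁ U ∣ C suc b) + ∣ ∁ U ∣ C b
  card-𝓗-∣U∣-1 {s} ∣U∣≡ b = begin
    _ ≡⟨ card-≐ (𝓗? U s (s + suc b)) (traces? U s (suc b) ∪? traces? U (suc s) b) ((λ {A} → to {A}) , (λ {A} → from {A})) ⟩
    _ ≡⟨ card-∪ (traces? U s (suc b)) (traces? U (suc s) b)
           (λ { (x , _) (y , _) → 1+n≢n (trans (sym y) x) }) ⟩
    _ ≡⟨ cong₂ _+_ (card-traces U s (suc b)) (card-traces U (suc s) b) ⟩
    _ ≡⟨ cong (λ x → (x C s) * (∣ ∁ U ∣ C suc b) + (x C suc s) * (∣ ∁ U ∣ C b)) ∣U∣≡ ⟩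
    _ ≡⟨ cong₂ (λ x y → x * (∣ ∁ U ∣ C suc b) + y * (∣ ∁ U ∣ C b)) [s+1]Cs≡s+1 (nCn≡1 (suc s)) ⟩
    _ ≡⟨ cong (suc s * (∣ ∁ U ∣ C suc b) +_) (*-identityˡ _) ⟩
    _ ∎
    where
    open ≡-Reasoning
    [s+1]Cs≡s+1 : suc s C s ≡ suc s
    [s+1]Cs≡s+1 = trans (nCk≡nC[n∸k] (n≤1+n s))
                    (trans (cong (suc s C_) (m+n∸n≡m 1 s)) (nC1≡n (suc s)))
    to : ∀ {A} → 𝓗 U s (s + suc b) A → (traces U s (suc b) ∪ traces U (suc s) b) A
    to {A} (r , s≤) with m≤n⇒m<n∨m≡n s≤
    ... | inj₁ s< = inj₂ (traces-intro A (trans r (+-suc s b))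
                      (≤-antisym (subst (∣ A ∩ U ∣ ≤_) ∣U∣≡ (∣A∩U∣≤∣U∣ A)) s<))
    ... | inj₂ s≡ = inj₁ (traces-intro A r (sym s≡))
    from : ∀ {A} → (traces U s (suc b) ∪ traces U (suc s) b) A → 𝓗 U s (s + suc b) A
    from {A} (inj₁ tr) = traces⇒∣A∣≡ A tr , ≤-reflexive (sym (proj₁ tr))
    from {A} (inj₂ tr) = trans (traces⇒∣A∣≡ A tr) (sym (+-suc s b))
                   , ≤-trans (n≤1+n s) (≤-reflexive (sym (proj₁ tr)))

-- Each strict inclusion adds at least one element, so k of them force a size gap of k between the
-- ends.
chain-ends : ∀ {n} k (A : Fin (suc k) → Subset n) → (∀ i → A (inject₁ i) ⊂ A (suc i)) →
             A zero ⊆ A (fromℕ k) × ∣ A zero ∣ + k ≤ ∣ A (fromℕ k) ∣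
chain-ends zero    A A⊂ = ⊆-refl , ≤-reflexive (+-identityʳ _)
chain-ends (suc k) A A⊂ with A₁⊆ , ∣A₁∣+k≤ ← chain-ends k (A ∘ suc) (A⊂ ∘ suc) =
  ⊆-trans (proj₁ (A⊂ zero)) A₁⊆ ,
  ≤-trans (≤-reflexive (+-suc _ k)) (≤-trans (+-monoˡ-≤ k (p⊂q⇒∣p∣<∣q∣ (A⊂ zero))) ∣A₁∣+k≤)

-- Families of k + 1 consecutive layers, the two extreme ones incomplete

module Layered {n : ℕ} (q k : ℕ) where

  middle : Family n
  middle = ⋃ (Fin (k ∸ 1)) λ i → layer (q + suc (toℕ i))

  middle? : Decidable middle
  middle? A = any? λ i → layer? (q + suc (toℕ i)) A

  -- `X` is the part kept on layer q and `Y` the part removed from layer q + k. `𝓑 q k T` unfolds to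
  -- the instance `X` = `𝓢 q T`, `Y` = `∇ (q + k) (𝓢 q T)`.
  layered : Family n → Family n → Family n
  layered X Y = X ∪ middle ∪ (layer (q + k) ∖ Y)

  layered? : ∀ {X Y} → Decidable X → Decidable Y → Decidable (layered X Y)
  layered? X? Y? = X? ∪? (middle? ∪? (λ A → layer? (q + k) A ×-dec ¬? (Y? A)))

  1+toℕ<k : (i : Fin (k ∸ 1)) → suc (toℕ i) < k
  1+toℕ<k i = 1+x<k (toℕ<n i)
    where
    1+x<k : ∀ {x k} → x < k ∸ 1 → suc x < k
    1+x<k {k = suc k} x<k = s≤s x<k

  module _ (k≥1 : 1 ≤ k) {X Y : Family n} (X⊆ : ∀ {A} → X A → layer q A) where

    -- The size depends on `X` and `Y` only through their cardinalities; the right-hand summands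
    -- besides `card X?` are shared by all such families. `card Y?` stands on the left to avoid
    -- subtraction.
    card-layered : (X? : Decidable X) (Y? : Decidable Y) → (∀ {A} → Y A → layer (q + k) A) →
      card (layered? X? Y?) + card Y? ≡ card X? + (card middle? + card (layer? {n} (q + k)))
    card-layered X? Y? Y⊆ = begin
      card (layered? X? Y?) + card Y?
        ≡⟨ cong (_+ card Y?) (card-∪ X? (middle? ∪? top?) X-disjoint) ⟩
      card X? + card (middle? ∪? top?) + card Y?
        ≡⟨ cong (λ x → card X? + x + card Y?) (card-∪ middle? top? middle-disjoint) ⟩
      card X? + (card middle? + card top?) + card Y?
        ≡⟨ trans (+-assoc (card X?) _ _) (cong (card X? +_) (+-assoc (card middle?) _ _)) ⟩
      card X? + (card middle? + (card top? + card Y?))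
        ≡⟨ cong (λ x → card X? + (card middle? + x)) (card-∖ (layer? (q + k)) Y? Y⊆) ⟩
      _ ∎
      where
      open ≡-Reasoning
      top? : Decidable (layer (q + k) ∖ Y)
      top? A = layer? (q + k) A ×-dec ¬? (Y? A)
      middle-disjoint : ∀ {A} → middle A → ¬ (layer (q + k) ∖ Y) A
      middle-disjoint (i , x) (y , _) =
        <⇒≢ (1+toℕ<k i) (+-cancelˡ-≡ q _ _ (trans (sym x) y))
      X-disjoint : ∀ {A} → X A → ¬ (middle ∪ (layer (q + k) ∖ Y)) A
      X-disjoint x (inj₁ (i , y)) = m+1+n≢m q (trans (sym y) (X⊆ x))
      X-disjoint x (inj₂ (y , _)) = <⇒≢ (m<m+n q k≥1) (trans (sym (X⊆ x)) y)

    layered-bounds : ∀ {A} → layered X Y A → q ≤ ∣ A ∣ × ∣ A ∣ ≤ q + k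
    layered-bounds (inj₁ x) =
      ≤-reflexive (sym (X⊆ x)) , ≤-trans (≤-reflexive (X⊆ x)) (m≤m+n q k)
    layered-bounds (inj₂ (inj₁ (i , y))) =
      subst (q ≤_) (sym y) (m≤m+n q _) , subst (_≤ q + k) (sym y) (+-monoʳ-≤ q (<⇒≤ (1+toℕ<k i)))
    layered-bounds (inj₂ (inj₂ (y , _))) =
      subst (q ≤_) (sym y) (m≤m+n q k) , ≤-reflexive y

    layered-bottom : ∀ {A} → layered X Y A → layer q A → X A
    layered-bottom (inj₁ x)              _ = x
    layered-bottom (inj₂ (inj₁ (i , y))) z = ⊥-elim (m+1+n≢m q (trans (sym y) z))
    layered-bottom (inj₂ (inj₂ (y , _))) z = ⊥-elim (<⇒≢ (m<m+n q k≥1) (trans (sym z) y))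

    layered-top : ∀ {A} → layered X Y A → layer (q + k) A → ¬ Y A
    layered-top (inj₁ x)              z = ⊥-elim (<⇒≢ (m<m+n q k≥1) (trans (sym (X⊆ x)) z))
    layered-top (inj₂ (inj₁ (i , y))) z =
      ⊥-elim (<⇒≢ (1+toℕ<k i) (+-cancelˡ-≡ q _ _ (trans (sym y) z)))
    layered-top (inj₂ (inj₂ (_ , ¬y))) _ = ¬y

    -- All sizes lie between q and q + k, so a chain of k + 1 members must start on layer q and end
    -- on layer q + k. Its last set then contains a member of `X`, hence lies in the removed `Y`.
    layered-Sperner : (∀ {A B} → X A → A ⊆ B → layer (q + k) B → Y B) → Sperner k (layered X Y)
    layered-Sperner X↑⊆Y (A , A∈ , A⊂) =
      layered-top (A∈ (fromℕ k)) top (X↑⊆Y (layered-bottom (A∈ zero) bottom) A₀⊆Aₖ top)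
      where
      A₀⊆Aₖ = proj₁ (chain-ends k A A⊂)
      ∣A₀∣+k≤∣Aₖ∣ = proj₂ (chain-ends k A A⊂)
      q≤∣A₀∣ = proj₁ (layered-bounds (A∈ zero))
      ∣Aₖ∣≤q+k = proj₂ (layered-bounds (A∈ (fromℕ k)))
      bottom : layer q (A zero)
      bottom = ≤-antisym (+-cancelʳ-≤ k _ _ (≤-trans ∣A₀∣+k≤∣Aₖ∣ ∣Aₖ∣≤q+k)) q≤∣A₀∣
      top : layer (q + k) (A (fromℕ k))
      top = ≤-antisym ∣Aₖ∣≤q+k (≤-trans (+-monoˡ-≤ k q≤∣A₀∣) ∣A₀∣+k≤∣Aₖ∣)

    -- Unless both sets lie on layer q, their sizes add up to at least 2q + 1 ≥ n + t, which forces
    -- t common elements. Only pairs from `X` rely on `X-int`.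
    layered-Intersecting : ∀ {t} → n + t ≤ suc (q + q) → Intersecting t X →
                           Intersecting t (layered X Y)
    layered-Intersecting {t} n+t≤1+2q X-int {A} {B} A∈ B∈
      with m≤n⇒m<n∨m≡n (proj₁ (layered-bounds A∈)) | m≤n⇒m<n∨m≡n (proj₁ (layered-bounds B∈))
    ... | inj₂ a | inj₂ b = X-int {A} {B} (layered-bottom A∈ (sym a)) (layered-bottom B∈ (sym b))
    ... | inj₁ a | _      = large (+-mono-≤ a (proj₁ (layered-bounds B∈)))
      where
      large : suc q + q ≤ ∣ A ∣ + ∣ B ∣ → t ≤ ∣ A ∩ B ∣
      large le = +-cancelˡ-≤ n _ _ (≤-trans n+t≤1+2q (≤-trans le (∣p∣+∣q∣≤n+∣p∩q∣ A B)))
    ... | inj₂ a | inj₁ b = large (+-mono-≤ (proj₁ (layered-bounds A∈)) b)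
      where
      large : q + suc q ≤ ∣ A ∣ + ∣ B ∣ → t ≤ ∣ A ∩ B ∣
      large le = +-cancelˡ-≤ n _ _ (≤-trans n+t≤1+2q
        (≤-trans (≤-reflexive (sym (+-suc q q))) (≤-trans le (∣p∣+∣q∣≤n+∣p∩q∣ A B))))

-- Stars, upper shadows and Frankl families as trace families

𝓗-Intersecting : ∀ {n} (U : Subset n) {t} r → ∣ U ∣ ≡ 2 + t → Intersecting t (𝓗 U (suc t) r)
𝓗-Intersecting U {t} r ∣U∣≡ {A} {B} (_ , a) (_ , b) = +-cancelˡ-≤ (2 + t) _ _ (begin
  2 + t + t                ≡⟨ +-suc (suc t) t ⟨
  suc t + suc t            ≤⟨ +-mono-≤ a b ⟩
  -- Two subsets of size at least t + 1 in a set of size t + 2 share at least t elements.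
  ∣ A ∩ U ∣ + ∣ B ∩ U ∣    ≤⟨ ∣p∩u∣+∣q∩u∣≤∣u∣+∣p∩q∣ A B U ⟩
  ∣ U ∣ + ∣ A ∩ B ∣        ≡⟨ cong (_+ ∣ A ∩ B ∣) ∣U∣≡ ⟩
  2 + t + ∣ A ∩ B ∣        ∎)
  where open ≤-Reasoning

𝓗-upward : ∀ {n} (U : Subset n) {s q r} {A B : Subset n} → 𝓗 U s q A → A ⊆ B → layer r B → 𝓗 U s r B
𝓗-upward U {A = A} {B} (_ , s≤) A⊆B ∣B∣≡ = ∣B∣≡ , ≤-trans s≤ (p⊆q⇒∣p∣≤∣q∣
  λ x∈ → x∈p∩q⁺ (A⊆B (p∩q⊆p A U x∈) , p∩q⊆q A U x∈))

𝓢≐𝓗 : ∀ {n} q (T : Subset n) → 𝓢 q T ≐ 𝓗 T ∣ T ∣ q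
𝓢≐𝓗 q T = (λ { (r , T⊆A) → r , q⊆p⇒∣q∣≤∣p∩q∣ T⊆A })
        , (λ { (r , le) → r , ∣q∣≤∣p∩q∣⇒q⊆p le })

-- The shadow of a star is again a star: when T ⊆ A and `∣ T ∣` ≤ q ≤ `∣ A ∣`, interpolation by
-- `between` supplies a set of size q between T and A.
∇𝓢≐𝓗 : ∀ {n q} k (T : Subset n) → ∣ T ∣ ≤ q → ∇ (q + k) (𝓢 q T) ≐ 𝓗 T ∣ T ∣ (q + k)
∇𝓢≐𝓗 {q = q} k T ∣T∣≤q = to , from
  where
  to : ∀ {A} → ∇ (q + k) (𝓢 q T) A → 𝓗 T ∣ T ∣ (q + k) A
  to (r , F , (_ , T⊆F) , F⊆A) = r , q⊆p⇒∣q∣≤∣p∩q∣ (⊆-trans T⊆F F⊆A)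
  from : ∀ {A} → 𝓗 T ∣ T ∣ (q + k) A → ∇ (q + k) (𝓢 q T) A
  from (r , le)
    with F , T⊆F , F⊆A , ∣F∣≡q ←
      between q (∣q∣≤∣p∩q∣⇒q⊆p le) ∣T∣≤q (subst (q ≤_) (sym r) (m≤m+n q k))
    = r , F , (∣F∣≡q , T⊆F) , F⊆A

-- Comparison of 𝓑 with the Frankl-type competitor

module _ {n : ℕ} (T U : Subset n) {u j r : ℕ} (n≡ : n ≡ suc u + 2 * (2 + r) + 1)
         (∣T∣≡t : ∣ T ∣ ≡ suc u) (∣U∣≡2+t : ∣ U ∣ ≡ 3 + u) where

  private
    -- Shifted parameters remove all subtractions: u = t - 1, j = k - 1, r = m - 2. The number v =
    -- 2m - 1 is the size of the complement of `U`, and 2 + v that of `T`.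
    t k m q v : ℕ
    t = suc u
    k = suc j
    m = 2 + r
    q = t + m
    v = suc (suc r + suc r)

  open Layered {n} q k

  private
    ∣∁T∣≡ : ∣ ∁ T ∣ ≡ 2 + v
    ∣∁T∣≡ = begin
      ∣ ∁ T ∣                ≡⟨ ∣∁p∣≡n∸∣p∣ T ⟩
      n ∸ ∣ T ∣              ≡⟨ cong₂ _∸_ (trans n≡ (eq u r)) ∣T∣≡t ⟩
      t + (2 + v) ∸ t        ≡⟨ m+n∸m≡n t (2 + v) ⟩
      2 + v                  ∎
      where
      open ≡-Reasoning
      eq : ∀ u r → suc u + 2 * (2 + r) + 1 ≡ suc u + (3 + (suc r + suc r))
      eq = solve-∀

    ∣∁U∣≡ : ∣ ∁ U ∣ ≡ v
    ∣∁U∣≡ = begin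
      ∣ ∁ U ∣                ≡⟨ ∣∁p∣≡n∸∣p∣ U ⟩
      n ∸ ∣ U ∣              ≡⟨ cong₂ _∸_ (trans n≡ (eq u r)) ∣U∣≡2+t ⟩
      2 + t + v ∸ (2 + t)    ≡⟨ m+n∸m≡n (2 + t) v ⟩
      v                      ∎
      where
      open ≡-Reasoning
      eq : ∀ u r → suc u + 2 * (2 + r) + 1 ≡ 3 + u + suc (suc r + suc r)
      eq = solve-∀

    card-𝓗T : ∀ {x} b → x ≡ t + b → card (𝓗? T ∣ T ∣ x) ≡ (2 + v) C b
    card-𝓗T b refl = begin
      card (𝓗? T ∣ T ∣ (t + b))      ≡⟨ cong (λ a → card (𝓗? T ∣ T ∣ (a + b))) ∣T∣≡t ⟨
      card (𝓗? T ∣ T ∣ (∣ T ∣ + b))  ≡⟨ card-𝓗-∣U∣ T b ⟩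
      ∣ ∁ T ∣ C b                    ≡⟨ cong (_C b) ∣∁T∣≡ ⟩
      (2 + v) C b                    ∎
      where open ≡-Reasoning

    card-𝓗U : ∀ {x} b → x ≡ suc t + suc b →
              card (𝓗? U (suc t) x) ≡ (3 + u) * (v C suc b) + v C b
    card-𝓗U b refl = trans (card-𝓗-∣U∣-1 U ∣U∣≡2+t b)
      (cong (λ a → (3 + u) * (a C suc b) + a C b) ∣∁U∣≡)

  𝓕 : Family n
  𝓕 = layered (𝓗 U (suc t) q) (𝓗 U (suc t) (q + k))

  𝓕? : Decidable 𝓕
  𝓕? = layered? (𝓗? U (suc t) q) (𝓗? U (suc t) (q + k))

  𝓕-Intersecting : Intersecting t 𝓕
  𝓕-Intersecting {A} {B} = layered-Intersecting (s≤s z≤n) proj₁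
    -- The size condition holds with equality, as n + t = 2q + 1.
    (≤-reflexive (trans (cong (_+ t) n≡) (eq u r)))
    (λ {A} {B} → 𝓗-Intersecting U q ∣U∣≡2+t {A} {B}) {A} {B}
    where
    eq : ∀ u r → suc u + 2 * (2 + r) + 1 + suc u ≡ suc (suc u + (2 + r) + (suc u + (2 + r)))
    eq = solve-∀

  𝓕-Sperner : Sperner k 𝓕
  𝓕-Sperner = layered-Sperner (s≤s z≤n) proj₁ (λ {A} {B} → 𝓗-upward U {A = A} {B})

  card-𝓑<card-𝓕 : 2 ≤ u * j → j ≤ suc r → card (𝓑? q k T) < card 𝓕?
  -- Adding both removed parts makes `card-layered` applicable to each family. The common term `Z`
  -- then drops out, leaving `X₁` + `Y₂` < `X₂` + `Y₁`.
  card-𝓑<card-𝓕 2≤uj j≤p = +-cancelʳ-< (Y₁ + Y₂) _ _ (begin-strict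
    card (𝓑? q k T) + (Y₁ + Y₂)    ≡⟨ +-assoc (card (𝓑? q k T)) Y₁ Y₂ ⟨
    card (𝓑? q k T) + Y₁ + Y₂      ≡⟨ cong (_+ Y₂) (card-layered (s≤s z≤n) proj₁ (𝓢? q T)
                                        (∇? (q + k) (𝓢? q T)) proj₁) ⟩
    X₁ + Z + Y₂                    ≡⟨ swap X₁ Z Y₂ ⟩
    X₁ + Y₂ + Z                    <⟨ +-monoˡ-< Z X₁+Y₂<X₂+Y₁ ⟩
    X₂ + Y₁ + Z                    ≡⟨ swap X₂ Z Y₁ ⟨
    X₂ + Z + Y₁                    ≡⟨ cong (_+ Y₁) (card-layered (s≤s z≤n) proj₁ (𝓗? U (suc t) q)
                                        (𝓗? U (suc t) (q + k)) proj₁) ⟨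
    card 𝓕? + Y₂ + Y₁              ≡⟨ trans (+-assoc (card 𝓕?) Y₂ Y₁)
                                        (cong (card 𝓕? +_) (+-comm Y₂ Y₁)) ⟩
    card 𝓕? + (Y₁ + Y₂)            ∎)
    where
    open ≤-Reasoning
    X₁ = card (𝓢? q T)
    X₂ = card (𝓗? U (suc t) q)
    Y₁ = card (∇? (q + k) (𝓢? q T))
    Y₂ = card (𝓗? U (suc t) (q + k))
    Z  = card middle? + card (layer? {n} (q + k))
    swap : ∀ x z y → x + z + y ≡ x + y + z
    swap = solve-∀
    q≡ : ∀ u r → suc u + (2 + r) ≡ 2 + u + suc r
    q≡ = solve-∀
    q+k≡t+ : ∀ u r j → suc u + (2 + r) + suc j ≡ suc u + (2 + (suc r + j))
    q+k≡t+ = solve-∀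
    q+k≡1+t+ : ∀ u r j → suc u + (2 + r) + suc j ≡ 2 + u + suc (suc r + j)
    q+k≡1+t+ = solve-∀
    ∣T∣≤q : ∣ T ∣ ≤ q
    ∣T∣≤q = ≤-trans (≤-reflexive ∣T∣≡t) (m≤m+n t m)
    X₁+Y₂<X₂+Y₁ : X₁ + Y₂ < X₂ + Y₁
    X₁+Y₂<X₂+Y₁ = subst₂ _<_
      (sym (cong₂ _+_
        (trans (card-≐ (𝓢? q T) (𝓗? T ∣ T ∣ q) (𝓢≐𝓗 q T)) (card-𝓗T m refl))
        (card-𝓗U (suc r + j) (q+k≡1+t+ u r j))))
      (sym (cong₂ _+_
        (card-𝓗U r (q≡ u r))
        (trans (card-≐ (∇? (q + k) (𝓢? q T)) (𝓗? T ∣ T ∣ (q + k)) (∇𝓢≐𝓗 k T ∣T∣≤q))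
          (card-𝓗T (2 + (suc r + j)) (q+k≡t+ u r j)))))
      (trace-count-< u j r 2≤uj j≤p)

  𝓕-beats-𝓑 : 2 ≤ u * j → j ≤ suc r →
    Σ[ 𝓖 ∈ Family n ] Σ[ 𝓖? ∈ Decidable 𝓖 ]
      (Intersecting t 𝓖 × Sperner k 𝓖 × card 𝓖? > card (𝓑? q k T))
  𝓕-beats-𝓑 2≤uj j≤p =
    𝓕 , 𝓕? , (λ {A} {B} → 𝓕-Intersecting {A} {B}) , 𝓕-Sperner , card-𝓑<card-𝓕 2≤uj j≤p

-- Parameters of the theorem and choice of U

q≡t+m : ∀ t m → (t + 2 * m + 1 + t ∸ 1) / 2 ≡ t + m
q≡t+m t m = trans (cong (_/ 2) (cong (_∸ 1) (eq t m))) (m*n/n≡m (t + m) 2)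
  where
  eq : ∀ t m → t + 2 * m + 1 + t ≡ suc ((t + m) * 2)
  eq = solve-∀

subset-of-size : ∀ n s → s ≤ n → Σ[ U ∈ Subset n ] ∣ U ∣ ≡ s
subset-of-size n s s≤n
  with U , _ , _ , ∣U∣≡s ← between {p = ⊥} {⊤} s (⊆-max ⊥)
         (subst (_≤ s) (sym (∣⊥∣≡0 n)) z≤n) (subst (s ≤_) (sym (∣⊤∣≡n n)) s≤n)
  = U , ∣U∣≡s

3+u≤n : ∀ u r → 3 + u ≤ suc u + 2 * (2 + r) + 1
3+u≤n u r = ≤-trans (m≤m+n (3 + u) (suc (suc r + suc r))) (≤-reflexive (eq u r))
  where
  eq : ∀ u r → 3 + u + suc (suc r + suc r) ≡ suc u + 2 * (2 + r) + 1
  eq = solve-∀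

theorem1p7 :
    ∀ (t k : ℕ) → t ≥ 2 → k ≥ 2 → k * (t ∸ 1) ≥ t + 1 →
    ∀ (m : ℕ) → m ≥ k →
    let n = t + 2 * m + 1
        q = (n + t ∸ 1) / 2
    in
    ∀ (T : Subset n) → ∣ T ∣ ≡ t →
    Σ[ 𝓕 ∈ Family n ] Σ[ 𝓕? ∈ Decidable 𝓕 ]
      (Intersecting t 𝓕 × Sperner k 𝓕 × card 𝓕? > card (𝓑? q k T))
theorem1p7 (suc u) (suc j) _ (s≤s (s≤s _)) k[t-1]≥t+1 (suc (suc r)) (s≤s j≤p) T ∣T∣≡t
  -- Any set of t + 2 elements can serve as `U`, since only the sizes of `T` and `U` enter the
  -- count.
  with U , ∣U∣≡2+t ← subset-of-size (suc u + 2 * (2 + r) + 1) (3 + u) (3+u≤n u r)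
  rewrite q≡t+m (suc u) (2 + r)
  = 𝓕-beats-𝓑 T U refl ∣T∣≡t ∣U∣≡2+t 2≤uj j≤p
  where
  2≤uj : 2 ≤ u * j
  -- Here k(t - 1) = u + j u and t + 1 = u + 2, so cancelling u from the hypothesis gives (k - 1)(t
  -- - 1) ≥ 2.
  2≤uj = subst (2 ≤_) (*-comm j u) (+-cancelˡ-≤ u _ _ (subst (_≤ u + j * u) 1+u+1≡u+2 k[t-1]≥t+1))
    where
    1+u+1≡u+2 : suc u + 1 ≡ u + 2
    1+u+1≡u+2 = sym (+-suc u 1)
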